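{- Let $I\sqcup\overline{J}$ be a partition of $[n]$ with $1\in I$ and $n\in\overline{J}$, and let $\nu$ be the lattice path associated with $(I,\overline J)$. Then covering $(I,\overline{J})$-forests are in bijection with $\nu$-Schröder trees.
   Context: Let $[n]=\{1,\dots,n\}$ with $n\ge 2$, and let $I\sqcup\overline J=[n]$ with $1\in I$, $n\in\overline J$. An $(I,\overline J)$-forest is a subgraph of the complete bipartite graph with parts $I$ and $\overline J$ that is increasing (each arc $(i,\overline j)$ with $i\in I$, $\overline j\in\overline J$ satisfies $i<\overline j$) and non-crossing (it does not contain two arcs $(i,\overline j)$ and $(i',\overline j')$ with $i<i'<\overline j<\overline j'$). A covering $(I,\overline J)$-forest is an $(I,\overline J)$-forest containing the arc $(1,n)$ and with no isolated nodes (every element of $[n]$ lies on some arc). The associated path $\nu$: label the $i$-th element of $I$ by $E_{i-1}$ and the $i$-th element of $\overline J$ by $N_{i-1}$; reading the labels of $k=2,\dots,n-1$ in increasing order gives a lattice path $\nu$, with east steps $E=(1,0)$ and north steps $N=(0,1)$, from $(0,0)$ to $(b,a)$ where $b=|I|-1$, $a=|\overline J|-1$. $R_\nu$ is the region weakly above $\nu$ inside the rectangle with corners $(0,0)$ and $(b,a)$. Two lattice points $p,q$ in $R_\nu$ are $\nu$-incompatible if $p$ is strictly southwest or strictly northeast of $q$ and the smallest rectangle containing $p$ and $q$ is contained in $R_\nu$; otherwise they are $\nu$-compatible. A $\nu$-Schröder tree is a set of pairwise $\nu$-compatible lattice points in $R_\nu$ which includes the point $(0,a)$ (the root) and such that each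 row and each column of the grid contains at least one point of the set. -}

module Defs where

open import Data.Bool.Base using (Bool; T; if_then_else_)
open import Data.Fin.Base as Fin using (Fin; zero; suc; fromℕ; inject₁)
open import Data.Fin.Subset using (Subset; Side; inside; outside; _∈_; ∁; ∣_∣)
open import Data.List.Base using (List; []; _∷_; foldl; tabulate)
open import Data.List.Membership.Propositional using () renaming (_∈_ to _∈ˡ_)
open import Data.List.Scans.Base using (scanl)
open import Data.Nat.Base using (ℕ; zero; suc; _+_; _∸_; _≤_; _<_; _⊓_; _⊔_)
open import Data.Nat.Properties using (+-suc; +-identityʳ)
open import Data.Product.Base using (_×_; _,_; proj₁; proj₂; ∃-syntax)
open import Data.Sum.Base using (_⊎_)
open import Data.Vec.Base using (Vec; []; _∷_; lookup)
open import Level using (0ℓ)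
open import Relation.Binary.Bundles using (Setoid)
import Relation.Binary.Construct.On as On
open import Relation.Binary.PropositionalEquality
  using (_≡_; refl; sym; cong; cong₂; _→-setoid_; module ≡-Reasoning)
open import Relation.Nullary.Negation using (¬_)

-- Finite sets of arcs and of lattice points are given by their indicator
-- functions; two such sets are equal when the indicators agree pointwise.

Indicator : Set → Set
Indicator X = X → Bool

infix 4 _∈ᵢ_

_∈ᵢ_ : {X : Set} → X → Indicator X → Set
x ∈ᵢ S = T (S x)

-- The ground set [n] is Fin n, the element k being represented by k - 1.
-- A partition I ⊔ J̄ of [n] is given by I, and J̄ is ∁ I.

record CoveringForest {m : ℕ} (I : Subset (2 + m)) : Set where
  field
    arcs        : Indicator (Fin (2 + m) × Fin (2 + m))
    bipartite   : ∀ {i j} → (i , j) ∈ᵢ arcs → i ∈ I × j ∈ ∁ I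
    increasing  : ∀ {i j} → (i , j) ∈ᵢ arcs → i Fin.< j
    noncrossing : ∀ {i j i′ j′} → (i , j) ∈ᵢ arcs → (i′ , j′) ∈ᵢ arcs →
                  ¬ (i Fin.< i′ × i′ Fin.< j × j Fin.< j′)
    longArc     : (zero , fromℕ (suc m)) ∈ᵢ arcs
    noIsolated  : ∀ k → (∃[ j ] (k , j) ∈ᵢ arcs) ⊎ (∃[ i ] (i , k) ∈ᵢ arcs)

CoveringForests : {m : ℕ} → Subset (2 + m) → Setoid 0ℓ 0ℓ
CoveringForests {m} I =
  On.setoid ((Fin (2 + m) × Fin (2 + m)) →-setoid Bool) (CoveringForest.arcs {m} {I})

data Step : Set where
  E N : Step

Path : Set
Path = List Step

Point : Set
Point = ℕ × ℕ

move : Point → Step → Point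
move (x , y) E = suc x , y
move (x , y) N = x , suc y

end : Path → Point
end = foldl move (0 , 0)

width height : Path → ℕ
width  ν = proj₁ (end ν)
height ν = proj₂ (end ν)

vertices : Path → List Point
vertices = scanl move (0 , 0)

step : Side → Step
step s = if s then E else N

-- The labels of 2, …, n - 1, where n = 2 + m.  The indices of the labels
-- E_{i-1}, N_{i-1} do not affect the path.

path : {m : ℕ} → Subset (2 + m) → Path
path I = tabulate (λ k → step (lookup I (suc (inject₁ k))))

-- Lattice points of the region weakly above ν in its bounding rectangle:
-- those lying on or above some vertex of ν in the same column.

record Region (ν : Path) (p : Point) : Set where
  field
    x≤width  : proj₁ p ≤ width ν
    y≤height : proj₂ p ≤ height ν
    above    : ∃[ y ] (proj₁ p , y) ∈ˡ vertices ν × y ≤ proj₂ p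

infix 4 _SW_

_SW_ : Point → Point → Set
(x , y) SW (x′ , y′) = x < x′ × y < y′

-- Lattice points of the smallest rectangle containing p and q.

record Box (p q r : Point) : Set where
  field
    left  : proj₁ p ⊓ proj₁ q ≤ proj₁ r
    right : proj₁ r ≤ proj₁ p ⊔ proj₁ q
    lower : proj₂ p ⊓ proj₂ q ≤ proj₂ r
    upper : proj₂ r ≤ proj₂ p ⊔ proj₂ q

-- A rectangle with lattice corners lies in the region above ν exactly when
-- its lattice points do, since ν has only unit E and N steps.

Incompatible : Path → Point → Point → Set
Incompatible ν p q = (p SW q ⊎ q SW p) × (∀ r → Box p q r → Region ν r)

Compatible : Path → Point → Point → Set
Compatible ν p q = ¬ Incompatible ν p q

record SchröderTree (ν : Path) : Set where
  field
    points     : Indicator Point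
    inRegion   : ∀ {p} → p ∈ᵢ points → Region ν p
    compatible : ∀ {p q} → p ∈ᵢ points → q ∈ᵢ points → Compatible ν p q
    root       : (0 , height ν) ∈ᵢ points
    rows       : ∀ y → y ≤ height ν → ∃[ x ] (x , y) ∈ᵢ points
    columns    : ∀ x → x ≤ width ν → ∃[ y ] (x , y) ∈ᵢ points

SchröderTrees : Path → Setoid 0ℓ 0ℓ
SchröderTrees ν = On.setoid (Point →-setoid Bool) (SchröderTree.points {ν})

-- The path of (I , J̄) ends at (∣I∣ - 1 , ∣J̄∣ - 1).

end-tabulate : ∀ {m} (v : Vec Side (suc m)) → lookup v (fromℕ m) ≡ outside → ∀ x y →
  foldl move (x , y) (tabulate (λ k → step (lookup v (inject₁ k))))
    ≡ (x + ∣ v ∣ , y + (∣ ∁ v ∣ ∸ 1))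
end-tabulate {zero} (outside ∷ []) refl x y =
  cong₂ _,_ (sym (+-identityʳ x)) (sym (+-identityʳ y))
end-tabulate {suc m} (inside ∷ v) eq x y
  rewrite end-tabulate v eq (suc x) y | +-suc x ∣ v ∣ = refl
end-tabulate {suc m} (outside ∷ v) eq x y
  rewrite end-tabulate v eq x (suc y) = cong (x + ∣ v ∣ ,_) (begin
    suc y + (∣ ∁ v ∣ ∸ 1)   ≡⟨ sym (+-suc y _) ⟩
    y + suc (∣ ∁ v ∣ ∸ 1)   ≡⟨ cong (y +_) (positive v eq) ⟩
    y + ∣ ∁ v ∣             ∎)
  where
  open ≡-Reasoning
  positive : ∀ {m} (v : Vec Side (suc m)) → lookup v (fromℕ m) ≡ outside →
             suc (∣ ∁ v ∣ ∸ 1) ≡ ∣ ∁ v ∣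
  positive             (outside ∷ v) _ = refl
  positive {suc m}     (inside ∷ v)  e = positive v e

end-path : ∀ {m} (I : Subset (2 + m)) →
  lookup I zero ≡ inside → lookup I (fromℕ (suc m)) ≡ outside →
  end (path I) ≡ (∣ I ∣ ∸ 1 , ∣ ∁ I ∣ ∸ 1)
end-path (inside ∷ v) refl eq = end-tabulate v eq 0 0

{-# OPTIONS --safe #-}

-- The arc (i , j̄) corresponds to the lattice point whose coordinates are the
-- rank of i in I and the rank of j̄ in J̄.  The vertex of ν in the column of i
-- reached by the step of i has height #{j̄ < i}, so the point of (i , j̄) lies
-- above ν exactly when i < j̄.  A rectangle with corners p SW q lies above ν as
-- soon as its south-east corner does, so the points of (i , j̄) and (i′ , j̄′)
-- are incompatible exactly when i < i′ < j̄ < j̄′.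

module Submission where

open import Defs
open import Data.Bool.Base using (T)
open import Data.Bool.Properties using (T-≡; T?; ⇔→≡)
open import Data.Fin.Base as Fin using (Fin; zero; suc; fromℕ; inject₁)
open import Data.Fin.Properties as Fin using (any?)
open import Data.Fin.Subset using (Subset; Side; inside; outside; _∈_; ∁; ∣_∣)
open import Data.Fin.Subset.Properties
  using (_∈?_; x∈∁p⇒x∉p; x∈p⇒x∉∁p; x∉p⇒x∈∁p)
open import Data.List.Base using (List; _∷_; inits; tabulate)
open import Data.List.Membership.Propositional using () renaming (_∈_ to _∈ˡ_)
import Data.List.Properties as List
open import Data.List.Relation.Unary.Any using (here; there)
open import Data.List.Scans.Base using (scanl)
open import Data.List.Scans.Properties using (scanl-defn)
open import Data.Nat.Base using (ℕ; zero; suc; _+_; _∸_; _≤_; _<_; z≤n; s≤s; s≤s⁻¹; >-nonZero)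
open import Data.Nat.Properties as ℕ using (+-suc; +-identityʳ)
open import Data.Product.Base using (_×_; _,_; proj₁; proj₂; ∃-syntax)
open import Data.Product.Properties using (≡-dec)
open import Data.Sum.Base using (_⊎_; inj₁; inj₂)
open import Data.Vec.Base using (Vec; []; _∷_; lookup; here; there)
open import Function.Base using (_∘_)
open import Function.Bundles using (Bijection; mk⇔; _⇔_)
open import Function.Construct.Composition using (_⇔-∘_)
open import Function.Construct.Symmetry using (⇔-sym)
open import Relation.Binary.PropositionalEquality
  using (_≡_; refl; sym; trans; cong; cong₂; subst; subst₂)
open import Relation.Nullary.Decidable.Core
  using (Dec; yes; no; ⌊_⌋; toWitness; fromWitness; _×-dec_)
open import Relation.Nullary.Negation using (¬_; contradiction)

-- Ranks of indices relative to a subset.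

private
  variable
    n : ℕ

-- Counts the elements of `p` strictly below `k`, whether or not `k` is in `p`, so that `rank J`
-- also measures heights at elements of `I`.
rank : Subset n → Fin n → ℕ
rank (_       ∷ p) zero    = 0
rank (inside  ∷ p) (suc k) = suc (rank p k)
rank (outside ∷ p) (suc k) = rank p k

rank-mono-≤ : (p : Subset n) {i j : Fin n} → i Fin.≤ j → rank p i ≤ rank p j
rank-mono-≤ (_       ∷ p) {zero}              _         = z≤n
rank-mono-≤ (inside  ∷ p) {suc i} {suc j} (s≤s i≤j) = s≤s (rank-mono-≤ p i≤j)
rank-mono-≤ (outside ∷ p) {suc i} {suc j} (s≤s i≤j) = rank-mono-≤ p i≤j

rank-mono-< : {p : Subset n} {i j : Fin n} → i ∈ p → i Fin.< j → rank p i < rank p j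
rank-mono-< {j = suc j}                   here        _         = s≤s z≤n
rank-mono-< {p = inside  ∷ _} {j = suc j} (there i∈p) (s≤s i<j) = s≤s (rank-mono-< i∈p i<j)
rank-mono-< {p = outside ∷ _} {j = suc j} (there i∈p) (s≤s i<j) = rank-mono-< i∈p i<j

rank-cancel-< : (p : Subset n) {i j : Fin n} → rank p i < rank p j → i Fin.< j
rank-cancel-< p r< = ℕ.≰⇒> (λ j≤i → ℕ.<⇒≱ r< (rank-mono-≤ p j≤i))

-- If `j < i`, then `j` itself is counted for `i` but not for `j`; this is where `j ∈ p` enters.
rank-cancel-≤ : {p : Subset n} {i j : Fin n} → j ∈ p → rank p i ≤ rank p j → i Fin.≤ j
rank-cancel-≤ j∈p r≤ = ℕ.≮⇒≥ (λ j<i → ℕ.<⇒≱ (rank-mono-< j∈p j<i) r≤)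

rank-injective : {p : Subset n} {i j : Fin n} → i ∈ p → j ∈ p → rank p i ≡ rank p j → i ≡ j
rank-injective i∈p j∈p r≡ = Fin.≤-antisym
  (rank-cancel-≤ j∈p (ℕ.≤-reflexive r≡)) (rank-cancel-≤ i∈p (ℕ.≤-reflexive (sym r≡)))

rank<∣p∣ : {p : Subset n} {i : Fin n} → i ∈ p → rank p i < ∣ p ∣
rank<∣p∣ here                          = s≤s z≤n
rank<∣p∣ {p = inside  ∷ _} (there i∈p) = s≤s (rank<∣p∣ i∈p)
rank<∣p∣ {p = outside ∷ _} (there i∈p) = rank<∣p∣ i∈p

rank-surjective : (p : Subset n) {x : ℕ} → x < ∣ p ∣ → ∃[ i ] i ∈ p × rank p i ≡ x
rank-surjective (inside  ∷ p) {zero}  _         = zero , here , refl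
rank-surjective (inside  ∷ p) {suc x} (s≤s x<) =
  let i , i∈p , r≡ = rank-surjective p x< in suc i , there i∈p , cong suc r≡
rank-surjective (outside ∷ p)         x<       =
  let i , i∈p , r≡ = rank-surjective p x< in suc i , there i∈p , r≡

suc-rank-last : {p : Subset (suc n)} → fromℕ n ∈ p → suc (rank p (fromℕ n)) ≡ ∣ p ∣
suc-rank-last {zero}  {inside  ∷ []} here         = refl
suc-rank-last {suc n} {inside  ∷ p}  (there n∈p) = cong suc (suc-rank-last n∈p)
suc-rank-last {suc n} {outside ∷ p}  (there n∈p) = suc-rank-last n∈p

rank-last : {p : Subset (suc n)} → fromℕ n ∈ p → rank p (fromℕ n) ≡ ∣ p ∣ ∸ 1
rank-last n∈p = cong (_∸ 1) (suc-rank-last n∈p)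

-- Vertices of the lattice path.

-- By `scanl-defn` both sides are folds over prefixes, and the nonempty prefixes of `x ∷ xs` are the
-- prefixes of `xs` with `x` put in front.
scanl-∷ : {A B : Set} (f : A → B → A) (e : A) (x : B) (xs : List B) →
          scanl f e (x ∷ xs) ≡ e ∷ scanl f (f e x) xs
scanl-∷ f e x xs = trans (scanl-defn f e (x ∷ xs))
  (cong (e ∷_) (trans (sym (List.map-∘ (inits xs))) (sym (scanl-defn f (f e x) xs))))

-- The last entry of `v` yields no step. Started at `(0 , 0)` with `v` the tail of `I`, this is
-- `vertices (path I)`.
pathFrom : Point → Vec Side (suc n) → List Point
pathFrom p v = scanl move p (tabulate (λ k → step (lookup v (inject₁ k))))

pathFrom-∷ : ∀ p s (v : Vec Side (suc n)) → pathFrom p (s ∷ v) ≡ p ∷ pathFrom (move p (step s)) v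
pathFrom-∷ p s v = scanl-∷ move p (step s) _

-- The vertex is the end of the east step of `i`, whence the `suc`. Since the last index lies in
-- `∁ v`, it differs from `i`, so `i` does have a step.
∈-pathFrom⁺ : {v : Subset (suc n)} {i : Fin (suc n)} → fromℕ n ∈ ∁ v → i ∈ v → ∀ x y →
              (suc x + rank v i , y + rank (∁ v) i) ∈ˡ pathFrom (x , y) v
∈-pathFrom⁺ {zero}  {inside  ∷ []} () here x y
∈-pathFrom⁺ {zero}  {_ ∷ []} _ (there ()) x y
∈-pathFrom⁺ {suc n} {inside ∷ v} _ here x y
  rewrite pathFrom-∷ (x , y) inside v | +-identityʳ x | +-identityʳ y = there (here refl)
∈-pathFrom⁺ {suc n} {inside ∷ v} {suc i} (there n∈) (there i∈v) x y
  rewrite pathFrom-∷ (x , y) inside v | +-suc x (rank v i) = there (∈-pathFrom⁺ n∈ i∈v (suc x) y)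
∈-pathFrom⁺ {suc n} {outside ∷ v} {suc i} (there n∈) (there i∈v) x y
  rewrite pathFrom-∷ (x , y) outside v | +-suc y (rank (∁ v) i) =
  there (∈-pathFrom⁺ n∈ i∈v x (suc y))

-- Here `k` is the entry whose step starts at the vertex; the last entry stands for the end of the
-- path.
∈-pathFrom⁻ : (v : Subset (suc n)) → ∀ {p} x y → p ∈ˡ pathFrom (x , y) v →
              ∃[ k ] p ≡ (x + rank v k , y + rank (∁ v) k)
∈-pathFrom⁻ {zero} (_ ∷ []) x y (here refl) =
  zero , sym (cong₂ _,_ (+-identityʳ x) (+-identityʳ y))
∈-pathFrom⁻ {suc n} (s ∷ v) {p} x y p∈ with subst (p ∈ˡ_) (pathFrom-∷ (x , y) s v) p∈
... | here refl = zero , sym (cong₂ _,_ (+-identityʳ x) (+-identityʳ y))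
∈-pathFrom⁻ {suc n} (inside ∷ v) x y p∈ | there p∈′ =
  let k , eq = ∈-pathFrom⁻ v (suc x) y p∈′
  in suc k , trans eq (cong₂ _,_ (sym (+-suc x _)) refl)
∈-pathFrom⁻ {suc n} (outside ∷ v) x y p∈ | there p∈′ =
  let k , eq = ∈-pathFrom⁻ v x (suc y) p∈′
  in suc k , trans eq (cong₂ _,_ refl (sym (+-suc y _)))

T-injective : ∀ {a b} → T a ⇔ T b → a ≡ b
T-injective e = ⇔→≡ (T-≡ ⇔-∘ (e ⇔-∘ ⇔-sym T-≡))

-- Arcs and lattice points, with ranks as coordinates.

module _ {m : ℕ} (v : Subset (suc m)) (n∈∁v : fromℕ m ∈ ∁ v) where

  I J : Subset (2 + m)
  I = inside ∷ v
  J = ∁ I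

  ν : Path
  ν = path I

  point : Fin (2 + m) × Fin (2 + m) → Point
  point (i , j) = rank I i , rank J j

  end-ν : end ν ≡ (∣ v ∣ , ∣ J ∣ ∸ 1)
  end-ν = end-path I refl (lookup-∁⁻ n∈∁v)
    where
    lookup-∁⁻ : ∀ {n} {p : Subset n} {i} → i ∈ ∁ p → lookup p i ≡ outside
    lookup-∁⁻ {p = outside ∷ _} here      = refl
    lookup-∁⁻ {p = _ ∷ _}       (there i∈) = lookup-∁⁻ i∈

  -- Makes the truncated `∣ J ∣ ∸ 1` a true predecessor in `≤height⁻`.
  0<∣J∣ : 0 < ∣ J ∣
  0<∣J∣ = ℕ.≤-<-trans z≤n (rank<∣p∣ n∈∁v)

  ≤width⁺ : ∀ {x} → x < ∣ I ∣ → x ≤ width ν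
  ≤width⁺ x< = subst (_ ≤_) (sym (cong proj₁ end-ν)) (s≤s⁻¹ x<)

  ≤width⁻ : ∀ {x} → x ≤ width ν → x < ∣ I ∣
  ≤width⁻ x≤ = s≤s (subst (_ ≤_) (cong proj₁ end-ν) x≤)

  ≤height⁺ : ∀ {y} → y < ∣ J ∣ → y ≤ height ν
  ≤height⁺ y< = subst (_ ≤_) (sym (cong proj₂ end-ν)) (ℕ.<⇒≤pred y<)

  ≤height⁻ : ∀ {y} → y ≤ height ν → y < ∣ J ∣
  ≤height⁻ y≤ = ℕ.m≤pred[n]⇒suc[m]≤n {{>-nonZero 0<∣J∣}} (subst (_ ≤_) (cong proj₂ end-ν) y≤)

  region⁺ : ∀ {i y} → i ∈ I → y < ∣ J ∣ → rank J i ≤ y → Region ν (rank I i , y)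
  region⁺ i∈I y< r≤y = record
    { x≤width  = ≤width⁺ (rank<∣p∣ i∈I)
    ; y≤height = ≤height⁺ y<
    ; above    = _ , vertex i∈I , r≤y
    }
    where
    vertex : ∀ {i} → i ∈ I → (rank I i , rank J i) ∈ˡ vertices ν
    -- The element 1 has no step; its vertex is the start of the path.
    vertex here        = here refl
    vertex (there i∈v) = ∈-pathFrom⁺ n∈∁v i∈v 0 0

  -- A vertex in this column has coordinates `rank v k` and `rank (∁ v) k`. As `rank I (suc k)` also
  -- counts the element 1, it exceeds `rank I i`, so `i` precedes `suc k` and the vertex has height
  -- at least `rank J i`.
  region⁻ : ∀ {i y} → Region ν (rank I i , y) → rank J i ≤ y
  region⁻ {i} R with Region.above R
  ... | y′ , y′∈ , y′≤y with ∈-pathFrom⁻ v 0 0 y′∈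
  ...   | k , eq = ℕ.≤-trans
    (rank-mono-≤ J (ℕ.<⇒≤ (rank-cancel-< I {i} {suc k} (s≤s (ℕ.≤-reflexive (cong proj₁ eq))))))
    (subst (_≤ _) (cong proj₂ eq) y′≤y)

  ∈I,J⇒≢ : ∀ {i j} → i ∈ I → j ∈ J → ¬ i ≡ j
  ∈I,J⇒≢ i∈I j∈J refl = x∈p⇒x∉∁p i∈I j∈J

  region-point⁺ : ∀ {i j} → i ∈ I → j ∈ J → i Fin.< j → Region ν (point (i , j))
  region-point⁺ i∈I j∈J i<j = region⁺ i∈I (rank<∣p∣ j∈J) (rank-mono-≤ J (ℕ.<⇒≤ i<j))

  region-point⁻ : ∀ {i j} → i ∈ I → j ∈ J → Region ν (point (i , j)) → i Fin.< j
  region-point⁻ {i} i∈I j∈J R =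
    -- Ranks give only `i ≤ j`; disjointness of `I` and `J` makes it strict.
    Fin.≤∧≢⇒< (rank-cancel-≤ {i = i} j∈J (region⁻ {i} R)) (∈I,J⇒≢ i∈I j∈J)

  crossing⇒incompatible : ∀ {i j i′ j′} → i ∈ I → j ∈ J → i′ ∈ I → j′ ∈ J →
    i Fin.< i′ → i′ Fin.< j → j Fin.< j′ → Incompatible ν (point (i , j)) (point (i′ , j′))
  crossing⇒incompatible {i} {j} {i′} {j′} i∈I j∈J i′∈I j′∈J i<i′ i′<j j<j′ =
    inj₁ (rᵢ< , rⱼ<) , box⊆region
    where
    rᵢ< : rank I i < rank I i′
    rᵢ< = rank-mono-< i∈I i<i′
    rⱼ< : rank J j < rank J j′
    rⱼ< = rank-mono-< j∈J j<j′
    box⊆region : ∀ r → Box (point (i , j)) (point (i′ , j′)) r → Region ν r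
    box⊆region (x , y) B =
      let x≤ = subst (x ≤_) (ℕ.m≤n⇒m⊔n≡n (ℕ.<⇒≤ rᵢ<)) (Box.right B)
          y≤ = subst (y ≤_) (ℕ.m≤n⇒m⊔n≡n (ℕ.<⇒≤ rⱼ<)) (Box.upper B)
          ≤y = subst (_≤ y) (ℕ.m≤n⇒m⊓n≡m (ℕ.<⇒≤ rⱼ<)) (Box.lower B)
          -- The column `x` belongs to some `k ∈ I` with `k ≤ i′ < j`, hence
          -- `rank J k ≤ rank J j ≤ y`.
          k , k∈I , r≡x = rank-surjective I (ℕ.≤-<-trans x≤ (rank<∣p∣ i′∈I))
          k≤i′ = rank-cancel-≤ {i = k} i′∈I (subst (_≤ rank I i′) (sym r≡x) x≤)
      in subst (λ x → Region ν (x , y)) r≡x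
           (region⁺ k∈I (ℕ.≤-<-trans y≤ (rank<∣p∣ j′∈J))
             (ℕ.≤-trans (rank-mono-≤ J {k} {j} (ℕ.<⇒≤ (ℕ.≤-<-trans k≤i′ i′<j))) ≤y))

  SW-incompatible⇒crossing : ∀ {i j i′ j′} → j ∈ J → i′ ∈ I →
    point (i , j) SW point (i′ , j′) →
    (∀ r → Box (point (i , j)) (point (i′ , j′)) r → Region ν r) →
    i Fin.< i′ × i′ Fin.< j × j Fin.< j′
  SW-incompatible⇒crossing j∈J i′∈I (rᵢ< , rⱼ<) box⊆region =
    rank-cancel-< I rᵢ< , region-point⁻ i′∈I j∈J (box⊆region _ southEast) , rank-cancel-< J rⱼ<
    where
    -- The corner `point (i′ , j)`, which lies in the region only if `i′ < j`.
    southEast : Box _ _ _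
    southEast = record
      { left  = ℕ.m⊓n≤n _ _
      ; right = ℕ.m≤n⊔m _ _
      ; lower = ℕ.m⊓n≤m _ _
      ; upper = ℕ.m≤m⊔n _ _
      }

  -- From forests to trees.

  module _ (F : CoveringForest I) where
    open CoveringForest F

    IsPointOfArc : Point → Set
    IsPointOfArc p = ∃[ i ] ∃[ j ] (i , j) ∈ᵢ arcs × point (i , j) ≡ p

    -- Points range over the infinite grid, but the search runs over the finitely many pairs
    -- `(i , j)`; this makes the indicator Boolean.
    isPointOfArc? : ∀ p → Dec (IsPointOfArc p)
    isPointOfArc? p = any? λ i → any? λ j →
      T? (arcs (i , j)) ×-dec ≡-dec ℕ._≟_ ℕ._≟_ (point (i , j)) p

    arcPoints : Indicator Point
    arcPoints p = ⌊ isPointOfArc? p ⌋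

    arcPoints⁻ : ∀ {p} → p ∈ᵢ arcPoints → IsPointOfArc p
    arcPoints⁻ {p} = toWitness {a? = isPointOfArc? p}

    arcPoints⁺ : ∀ {i j p} → (i , j) ∈ᵢ arcs → point (i , j) ≡ p → p ∈ᵢ arcPoints
    arcPoints⁺ {p = p} a eq = fromWitness {a? = isPointOfArc? p} (_ , _ , a , eq)

    toTree : SchröderTree ν
    toTree = record
      { points     = arcPoints
      ; inRegion   = inRegion
      ; compatible = compatible
      ; root       = arcPoints⁺ longArc (cong (0 ,_)
                       (trans (rank-last n∈∁v) (sym (cong proj₂ end-ν))))
      ; rows       = rows
      ; columns    = columns
      }
      where
      inRegion : ∀ {p} → p ∈ᵢ arcPoints → Region ν p
      inRegion p∈ with arcPoints⁻ p∈
      ... | i , j , a , refl =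
        region-point⁺ (proj₁ (bipartite a)) (proj₂ (bipartite a)) (increasing a)

      compatible : ∀ {p q} → p ∈ᵢ arcPoints → q ∈ᵢ arcPoints → Compatible ν p q
      compatible p∈ q∈ (sw , box) with arcPoints⁻ p∈ | arcPoints⁻ q∈
      compatible p∈ q∈ (inj₁ sw , box) | i , j , a , refl | i′ , j′ , a′ , refl =
        noncrossing a a′
          (SW-incompatible⇒crossing (proj₂ (bipartite a)) (proj₁ (bipartite a′)) sw box)
      compatible {p} {q} p∈ q∈ (inj₂ sw , box) | i , j , a , refl | i′ , j′ , a′ , refl =
        -- Boxes are symmetric in their two corners, so the arcs exchange roles.
        noncrossing a′ a
          (SW-incompatible⇒crossing (proj₂ (bipartite a′)) (proj₁ (bipartite a)) sw
            (λ r B → box r (swap B)))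
        where
        swap : ∀ {r} → Box q p r → Box p q r
        swap B = record
          { left  = subst (_≤ _) (ℕ.⊓-comm (proj₁ q) (proj₁ p)) (Box.left B)
          ; right = subst (_ ≤_) (ℕ.⊔-comm (proj₁ q) (proj₁ p)) (Box.right B)
          ; lower = subst (_≤ _) (ℕ.⊓-comm (proj₂ q) (proj₂ p)) (Box.lower B)
          ; upper = subst (_ ≤_) (ℕ.⊔-comm (proj₂ q) (proj₂ p)) (Box.upper B)
          }

      rows : ∀ y → y ≤ height ν → ∃[ x ] (x , y) ∈ᵢ arcPoints
      rows y y≤ with rank-surjective J (≤height⁻ y≤)
      ... | j , j∈J , r≡y with noIsolated j
      -- An element of `J` cannot be the left end of an arc, so the arc covering it ends there and
      -- gives a point in its row.
      ...   | inj₁ (_ , a) = contradiction j∈J (x∈p⇒x∉∁p (proj₁ (bipartite a)))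
      ...   | inj₂ (i , a) = rank I i , arcPoints⁺ a (cong (_ ,_) r≡y)

      columns : ∀ x → x ≤ width ν → ∃[ y ] (x , y) ∈ᵢ arcPoints
      columns x x≤ with rank-surjective I (≤width⁻ x≤)
      ... | i , i∈I , r≡x with noIsolated i
      ...   | inj₁ (j , a) = rank J j , arcPoints⁺ a (cong (_, _) r≡x)
      ...   | inj₂ (_ , a) = contradiction i∈I (x∈∁p⇒x∉p (proj₂ (bipartite a)))

  -- Ranks are injective on `I` and on `J`, so the arc of `G` behind the shared point is the given
  -- arc of `F`.
  arcPoints-cong⁻ : (F G : CoveringForest I) → (∀ p → p ∈ᵢ arcPoints F → p ∈ᵢ arcPoints G) →
    ∀ {i j} → (i , j) ∈ᵢ CoveringForest.arcs F → (i , j) ∈ᵢ CoveringForest.arcs G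
  arcPoints-cong⁻ F G F⊆G a with arcPoints⁻ G (F⊆G _ (arcPoints⁺ F a refl))
  ... | i′ , j′ , a′ , eq =
    let i∈I  , j∈J  = CoveringForest.bipartite F a
        i′∈I , j′∈J = CoveringForest.bipartite G a′
    in subst₂ (λ i j → (i , j) ∈ᵢ CoveringForest.arcs G)
         (rank-injective i′∈I i∈I (cong proj₁ eq)) (rank-injective j′∈J j∈J (cong proj₂ eq)) a′

  -- From trees to forests.

  module _ (S : SchröderTree ν) where
    open SchröderTree S

    -- Ranks are defined off `I` and `J` too, so the memberships single out the one pair that stands
    -- for a given point.
    IsArcOfPoint : Fin (2 + m) × Fin (2 + m) → Set
    IsArcOfPoint (i , j) = i ∈ I × j ∈ J × point (i , j) ∈ᵢ points

    isArcOfPoint? : ∀ a → Dec (IsArcOfPoint a)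
    isArcOfPoint? (i , j) = (i ∈? I) ×-dec (j ∈? J) ×-dec T? (points (point (i , j)))

    pointArcs : Indicator (Fin (2 + m) × Fin (2 + m))
    pointArcs a = ⌊ isArcOfPoint? a ⌋

    pointArcs⁻ : ∀ {a} → a ∈ᵢ pointArcs → IsArcOfPoint a
    pointArcs⁻ {a} = toWitness {a? = isArcOfPoint? a}

    pointArcs⁺ : ∀ {a} → IsArcOfPoint a → a ∈ᵢ pointArcs
    pointArcs⁺ {a} = fromWitness {a? = isArcOfPoint? a}

    toForest : CoveringForest I
    toForest = record
      { arcs        = pointArcs
      ; bipartite   = λ a → let i∈I , j∈J , _ = pointArcs⁻ a in i∈I , j∈J
      ; increasing  = λ a → let i∈I , j∈J , p∈ = pointArcs⁻ a
                            in region-point⁻ i∈I j∈J (inRegion p∈)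
      ; noncrossing = λ a a′ (i<i′ , i′<j , j<j′) →
          let i∈I  , j∈J  , p∈ = pointArcs⁻ a
              i′∈I , j′∈J , q∈ = pointArcs⁻ a′
          in compatible p∈ q∈
               (crossing⇒incompatible i∈I j∈J i′∈I j′∈J i<i′ i′<j j<j′)
      ; longArc     = pointArcs⁺ (here , there n∈∁v ,
          subst (λ y → (0 , y) ∈ᵢ points) (trans (cong proj₂ end-ν) (sym (rank-last n∈∁v))) root)
      ; noIsolated  = noIsolated
      }
      where
      noIsolated : ∀ k → (∃[ j ] (k , j) ∈ᵢ pointArcs) ⊎ (∃[ i ] (i , k) ∈ᵢ pointArcs)
      noIsolated k = split (k ∈? I)
        where
        split : Dec (k ∈ I) → (∃[ j ] (k , j) ∈ᵢ pointArcs) ⊎ (∃[ i ] (i , k) ∈ᵢ pointArcs)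
        split (yes k∈I) =
          let y , p∈ = columns (rank I k) (≤width⁺ (rank<∣p∣ k∈I))
              -- Lying in the region bounds `y` by the height, so `y` is the rank of some `j ∈ J`.
              j , j∈J , r≡y = rank-surjective J (≤height⁻ (Region.y≤height (inRegion p∈)))
          in inj₁ (j , pointArcs⁺ (k∈I , j∈J , subst (λ y → (_ , y) ∈ᵢ points) (sym r≡y) p∈))
        split (no k∉I) =
          let k∈J = x∉p⇒x∈∁p k∉I
              x , p∈ = rows (rank J k) (≤height⁺ (rank<∣p∣ k∈J))
              i , i∈I , r≡x = rank-surjective I (≤width⁻ (Region.x≤width (inRegion p∈)))
          in inj₂ (i , pointArcs⁺ (i∈I , k∈J , subst (λ x → (x , _) ∈ᵢ points) (sym r≡x) p∈))

  -- The bijection, up to pointwise equality of indicators.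

  arcPoints-toForest : (S : SchröderTree ν) →
    ∀ p → p ∈ᵢ arcPoints (toForest S) ⇔ p ∈ᵢ SchröderTree.points S
  arcPoints-toForest S p = mk⇔ ⇒ ⇐
    where
    open SchröderTree S
    ⇒ : p ∈ᵢ arcPoints (toForest S) → p ∈ᵢ points
    ⇒ p∈ with arcPoints⁻ (toForest S) p∈
    ... | _ , _ , a , refl = proj₂ (proj₂ (pointArcs⁻ S a))
    ⇐ : p ∈ᵢ points → p ∈ᵢ arcPoints (toForest S)
    ⇐ p∈ =
      let R = inRegion p∈
          i , i∈I , r≡x = rank-surjective I (≤width⁻ (Region.x≤width R))
          j , j∈J , r≡y = rank-surjective J (≤height⁻ (Region.y≤height R))
          eq = cong₂ _,_ r≡x r≡y
      in arcPoints⁺ (toForest S) (pointArcs⁺ S (i∈I , j∈J , subst (_∈ᵢ points) (sym eq) p∈)) eq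

  toTree-cong : {F G : CoveringForest I} →
    (∀ a → CoveringForest.arcs F a ≡ CoveringForest.arcs G a) →
    ∀ p → arcPoints F p ≡ arcPoints G p
  toTree-cong {F} {G} F≈G p = T-injective (mk⇔ (transfer F G F≈G) (transfer G F (sym ∘ F≈G)))
    where
    transfer : ∀ F G → (∀ a → CoveringForest.arcs F a ≡ CoveringForest.arcs G a) →
               p ∈ᵢ arcPoints F → p ∈ᵢ arcPoints G
    transfer F G F≈G p∈ =
      let _ , _ , a , eq = arcPoints⁻ F p∈ in arcPoints⁺ G (subst T (F≈G _) a) eq

  toTree-injective : {F G : CoveringForest I} → (∀ p → arcPoints F p ≡ arcPoints G p) →
    ∀ a → CoveringForest.arcs F a ≡ CoveringForest.arcs G a
  toTree-injective {F} {G} F≈G a = T-injective (mk⇔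
    (arcPoints-cong⁻ F G (λ p → subst T (F≈G p)))
    (arcPoints-cong⁻ G F (λ p → subst T (sym (F≈G p)))))

  forest⤖tree : Bijection (CoveringForests I) (SchröderTrees ν)
  forest⤖tree = record
    { to        = toTree
    ; cong      = λ {F} {G} → toTree-cong {F} {G}
    -- Surjectivity concerns every `F` with the same arcs as `toForest S`; `toTree-cong` reduces it
    -- to `toForest S` itself.
    ; bijective = (λ {F} {G} → toTree-injective {F} {G}) , λ S → toForest S , λ {F} F≈ p →
        trans (toTree-cong {F} {toForest S} F≈ p) (T-injective (arcPoints-toForest S p))
    }

theorem4p2 : (m : ℕ) (I : Subset (2 + m)) → zero ∈ I → fromℕ (suc m) ∈ ∁ I →
    Bijection (CoveringForests I) (SchröderTrees (path I))
theorem4p2 m (inside ∷ v) here (there n∈∁v) = forest⤖tree v n∈∁v
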